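{- Let $(A,B)$ be an interpolation problem and let $a=b$ be a mixed literal, with $a$ $A$-local and $b$ $B$-local, and auxiliary variables $x$ (of the same type as $a$ and $b$) and $p_x$ (Boolean). Suppose that $I_1[EQ(x,s_1)]\ldots[EQ(x,s_n)]$ is a partial interpolant of the clause $C_1\lor a=b$, where $s_1,\ldots,s_n$ are terms, the sub-formulae $EQ(x,s_i) := (p_x \mathrel{\mathrm{xor}} (x=s_i))$ occur only positively, and $x$ and $p_x$ occur nowhere in this formula except as the displayed $x$ and $p_x$ in the $EQ(x,s_i)$. Suppose that $I_2(x)$ is a partial interpolant of the clause $C_2\lor a\neq b$ (where $x$ may occur at arbitrary positions). Then $I_1[I_2(s_1)]\ldots[I_2(s_n)]$, obtained by replacing each $EQ(x,s_i)$ by $I_2(s_i)$ (that is, $I_2$ with every $x$ substituted by $s_i$), is a partial interpolant of the clause $C_1\lor C_2$.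
   Context: Formulae are quantifier-free first-order formulae in the combined theory of equality with uninterpreted functions and linear arithmetic over $\mathbb{Q}$ and $\mathbb{Z}$ (with the integer division-by-constant functions $\lfloor\cdot/k\rfloor$, $k\ge 1$, in the signature); $\models$ is entailment in this theory. $\mathrm{symb}(F)$ is the set of non-theory symbols of $F$. An interpolation problem is a pair $(A,B)$ of formulae with $A\land B\models\bot$. A symbol is shared if it is in $\mathrm{symb}(A)\cap\mathrm{symb}(B)$, $A$-local if in $\mathrm{symb}(A)\setminus\mathrm{symb}(B)$, $B$-local if in $\mathrm{symb}(B)\setminus\mathrm{symb}(A)$. A term/literal is $A$-local ($B$-local) if it contains at least one $A$-local ($B$-local) symbol and no $B$-local ($A$-local) symbol, shared if it contains only shared symbols, mixed if it contains both $A$-local and $B$-local symbols. Projections. Each literal $\ell$ has projections $\ell\downharpoonright A$, $\ell\downharpoonright B$, extended to conjunctions of literals component-wise. For non-mixed literals: if $\ell$ is $A$-local, $\ell\downharpoonright A=\ell$ and $\ell\downharpoonright B=\top$; if $\ell$ is $B$-local, $\ell\downharpoonright A=\top$ and $\ell\downharpoonright B=\ell$; if $\ell$ is shared, then either (Pudlák) $\ell\downharpoonright A=\ell\downharpoonright B=\ell$, or (McMillan) $\ell\downharpoonright A=\top$, $\ell\downharpoonright B=\ell$, the choice being fixed throughout. For mixed literals, fresh auxiliary variables are used: $(a=b)\downharpoonright A := (a=x)$, $(a=b)\downharpoonright B := (x=b)$; $(a\neq b)\downharpoonright A := (p_x \mathrel{\mathrm{xor}} (a=x))$, $(a\neq b)\downharpoonright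 B := (\lnot p_x \mathrel{\mathrm{xor}} (x=b))$, with the same $x$ for $a=b$ and $a\ne b$; $(a+b\le c)\downharpoonright A := (a+x\le 0)$, $(a+b\le c)\downharpoonright B := (-x+b\le c)$, where $a$ is a linear combination of $A$-local variables, $b$ a linear combination of $B$-local and shared variables, $c$ a constant; a mixed inequality and its negation (rewritten as an inequality of the same form) have different auxiliary variables. Auxiliary variables belonging to different atoms are distinct, are fresh (do not occur in $A$, $B$ or the clauses), and count as shared symbols. Partial interpolant. A partial interpolant of a clause $C$ is a formula $I$ that is an interpolant of $A\land(\lnot C\downharpoonright A)$ and $B\land(\lnot C\downharpoonright B)$ ($\lnot C$ being a conjunction of literals), i.e. (i) $A\land\lnot C\downharpoonright A\models I$, (ii) $B\land\lnot C\downharpoonright B\land I\models\bot$, (iii) every non-theory symbol of $I$ is in $\mathrm{symb}(A)\cap\mathrm{symb}(B)$ or is an auxiliary variable introduced by the projections of the literals of $\lnot C$. $F[G_1]\ldots[G_n]$ denotes a formula in negation normal form with sub-formulae $G_1,\ldots,G_n$ occurring positively; $F[G_1']\ldots[G_n']$ is the result of replacing them by $G_1',\ldots,G_n'$. $F(t)$ denotes a formula with a sub-term $t$ that can appear anywhere, and $F(t')$ is the result of substituting $t'$ for it. Clauses are built over the literals of the proof, and $C_1,C_2$ contain neither the pivot literal nor its negation. -}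

module Defs where

open import Data.Bool using (Bool; true; false; T)
import Data.Bool as Bool
open import Data.Fin using (Fin)
open import Data.Integer using (ℤ; 0ℤ; 1ℤ; -1ℤ)
import Data.Integer as ℤ
import Data.Integer.DivMod as ℤ
open import Data.List using (List; []; _∷_; _++_; [_])
open import Data.List.Membership.Propositional using (_∈_; _∉_)
open import Data.List.Relation.Unary.All using (All; []; _∷_)
open import Data.List.Relation.Unary.Any using (Any)
open import Data.Nat using (ℕ; NonZero)
open import Data.Product using (∃; ∃₂; _×_; _,_; proj₂)
open import Data.Rational using (ℚ)
import Data.Rational as ℚ
open import Data.Sign using (Sign; opposite)
open import Data.Sum using (_⊎_)
open import Relation.Binary.Definitions using (DecidableEquality)
open import Relation.Binary.PropositionalEquality using (_≡_; refl)
open import Relation.Nullary using (¬_; yes; no; does)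

data Num : Set where
  int rat : Num

Scalar : Num → Set
Scalar int = ℤ
Scalar rat = ℚ

data Sort (U : Set) : Set where
  num     : Num → Sort U
  uninter : U → Sort U

-- The non-theory symbols.  Variables are the symbols without arguments.
record Signature : Set₁ where
  field
    U    : Set
    Fun  : List (Sort U) → Sort U → Set
    Rel  : List (Sort U) → Set
    _≟ᶠ_ : DecidableEquality (∃₂ Fun)
    _≟ʳ_ : DecidableEquality (∃ Rel)

open Signature using (U; Fun; Rel)

data Symbol (Sg : Signature) : Set where
  funSym : ∀ {Γ σ} → Fun Sg Γ σ → Symbol Sg
  relSym : ∀ {Γ} → Rel Sg Γ → Symbol Sg

infixl 7 _⊕_
infixr 8 _·_
infix  6 _≐_ _≼_

data Term (Sg : Signature) : Sort (U Sg) → Set where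
  app   : ∀ {Γ σ} → Fun Sg Γ σ → All (Term Sg) Γ → Term Sg σ
  const : ∀ {ν} → Scalar ν → Term Sg (num ν)
  _⊕_   : ∀ {ν} → Term Sg (num ν) → Term Sg (num ν) → Term Sg (num ν)
  _·_   : ∀ {ν} → Scalar ν → Term Sg (num ν) → Term Sg (num ν)
  ⌊_/_⌋ : Term Sg (num int) → (k : ℕ) → .{{NonZero k}} → Term Sg (num int)

data Atom (Sg : Signature) : Set where
  rel : ∀ {Γ} → Rel Sg Γ → All (Term Sg) Γ → Atom Sg
  _≐_ : ∀ {σ} → Term Sg σ → Term Sg σ → Atom Sg
  _≼_ : ∀ {ν} → Term Sg (num ν) → Term Sg (num ν) → Atom Sg

infix  5 ∼_
infixr 4 _∧_
infixr 3 _∨_ _xor_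

data Formula (Sg : Signature) : Set where
  ⊤ ⊥     : Formula Sg
  atom    : Atom Sg → Formula Sg
  ∼_      : Formula Sg → Formula Sg
  _∧_ _∨_ : Formula Sg → Formula Sg → Formula Sg

_xor_ : ∀ {Sg} → Formula Sg → Formula Sg → Formula Sg
φ xor ψ = (φ ∧ ∼ ψ) ∨ (∼ φ ∧ ψ)

Literal : Signature → Set
Literal Sg = Sign × Atom Sg

Clause : Signature → Set
Clause Sg = List (Literal Sg)

pattern pos α = (Sign.+ , α)
pattern neg α = (Sign.- , α)

literal : ∀ {Sg} → Literal Sg → Formula Sg
literal (pos α) = atom α
literal (neg α) = ∼ atom α

var : ∀ {Sg σ} → Fun Sg [] σ → Term Sg σ
var f = app f []

-- Formulae in negation normal form with n sub-formulae left open; since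
-- negation is confined to `lit`, these occur only positively.
data NNF (Sg : Signature) (n : ℕ) : Set where
  hole    : Fin n → NNF Sg n
  lit     : Literal Sg → NNF Sg n
  ⊤ ⊥     : NNF Sg n
  _∧_ _∨_ : NNF Sg n → NNF Sg n → NNF Sg n

fill : ∀ {Sg n} → NNF Sg n → (Fin n → Formula Sg) → Formula Sg
fill (hole i) G = G i
fill (lit ℓ)  G = literal ℓ
fill ⊤        G = ⊤
fill ⊥        G = ⊥
fill (F ∧ F′) G = fill F G ∧ fill F′ G
fill (F ∨ F′) G = fill F G ∨ fill F′ G

module _ {Sg : Signature} where

  mutual
    symbᵗ : ∀ {σ} → Term Sg σ → List (Symbol Sg)
    symbᵗ (app f ts)  = funSym f ∷ symbᵗˢ ts
    symbᵗ (const _)   = []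
    symbᵗ (t ⊕ u)     = symbᵗ t ++ symbᵗ u
    symbᵗ (_ · t)     = symbᵗ t
    symbᵗ (⌊ t / _ ⌋) = symbᵗ t

    symbᵗˢ : ∀ {Γ} → All (Term Sg) Γ → List (Symbol Sg)
    symbᵗˢ []       = []
    symbᵗˢ (t ∷ ts) = symbᵗ t ++ symbᵗˢ ts

  symbᵃ : Atom Sg → List (Symbol Sg)
  symbᵃ (rel r ts) = relSym r ∷ symbᵗˢ ts
  symbᵃ (t ≐ u)    = symbᵗ t ++ symbᵗ u
  symbᵃ (t ≼ u)    = symbᵗ t ++ symbᵗ u

  symb : Formula Sg → List (Symbol Sg)
  symb ⊤        = []
  symb ⊥        = []
  symb (atom α) = symbᵃ α
  symb (∼ φ)    = symb φ
  symb (φ ∧ ψ)  = symb φ ++ symb ψ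
  symb (φ ∨ ψ)  = symb φ ++ symb ψ

  module _ {τ} (x : Fun Sg [] τ) (s : Term Sg τ) where
    open Signature Sg using (_≟ᶠ_)

    mutual
      substᵗ : ∀ {σ} → Term Sg σ → Term Sg σ
      substᵗ (app {Γ} {σ} f ts) with (Γ , σ , f) ≟ᶠ ([] , τ , x)
      ... | yes refl = s
      ... | no  _    = app f (substᵗˢ ts)
      substᵗ (const c)   = const c
      substᵗ (t ⊕ u)     = substᵗ t ⊕ substᵗ u
      substᵗ (c · t)     = c · substᵗ t
      substᵗ (⌊ t / k ⌋) = ⌊ substᵗ t / k ⌋

      substᵗˢ : ∀ {Γ} → All (Term Sg) Γ → All (Term Sg) Γ
      substᵗˢ []       = []
      substᵗˢ (t ∷ ts) = substᵗ t ∷ substᵗˢ ts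

    substᵃ : Atom Sg → Atom Sg
    substᵃ (rel r ts) = rel r (substᵗˢ ts)
    substᵃ (t ≐ u)    = substᵗ t ≐ substᵗ u
    substᵃ (t ≼ u)    = substᵗ t ≼ substᵗ u

    subst : Formula Sg → Formula Sg
    subst ⊤        = ⊤
    subst ⊥        = ⊥
    subst (atom α) = atom (substᵃ α)
    subst (∼ φ)    = ∼ subst φ
    subst (φ ∧ ψ)  = subst φ ∧ subst ψ
    subst (φ ∨ ψ)  = subst φ ∨ subst ψ

Value : ∀ {U} → (U → Set) → Sort U → Set
Value Carrier (num ν)     = Scalar ν
Value Carrier (uninter u) = Carrier u

-- Truth values are Booleans, and equality on the uninterpreted sorts is
-- decidable, so that the logic of entailment is classical.
record Model (Sg : Signature) : Set₁ where
  field
    Carrier : U Sg → Set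
    _≟_     : ∀ {u} → DecidableEquality (Carrier u)
    point   : ∀ u → Carrier u

    ⟦fun⟧   : ∀ {Γ σ} → Fun Sg Γ σ → All (Value Carrier) Γ → Value Carrier σ
    ⟦rel⟧   : ∀ {Γ} → Rel Sg Γ → All (Value Carrier) Γ → Bool

  ⟦_⟧ˢ : Sort (U Sg) → Set
  ⟦_⟧ˢ = Value Carrier

  eqᵇ : ∀ σ → ⟦ σ ⟧ˢ → ⟦ σ ⟧ˢ → Bool
  eqᵇ (num int)   v w = does (v ℤ.≟ w)
  eqᵇ (num rat)   v w = does (v ℚ.≟ w)
  eqᵇ (uninter u) v w = does (v ≟ w)

  leᵇ : ∀ ν → Scalar ν → Scalar ν → Bool
  leᵇ int v w = does (v ℤ.≤? w)
  leᵇ rat v w = does (v ℚ.≤? w)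

  add : ∀ ν → Scalar ν → Scalar ν → Scalar ν
  add int = ℤ._+_
  add rat = ℚ._+_

  mul : ∀ ν → Scalar ν → Scalar ν → Scalar ν
  mul int = ℤ._*_
  mul rat = ℚ._*_

  mutual
    ⟦_⟧ᵗ : ∀ {σ} → Term Sg σ → ⟦ σ ⟧ˢ
    ⟦ app f ts ⟧ᵗ     = ⟦fun⟧ f ⟦ ts ⟧ᵗˢ
    ⟦ const c ⟧ᵗ      = c
    ⟦ _⊕_ {ν} t u ⟧ᵗ  = add ν ⟦ t ⟧ᵗ ⟦ u ⟧ᵗ
    ⟦ _·_ {ν} c t ⟧ᵗ  = mul ν c ⟦ t ⟧ᵗ
    ⟦ ⌊ t / k ⌋ ⟧ᵗ    = ⟦ t ⟧ᵗ ℤ./ℕ k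

    ⟦_⟧ᵗˢ : ∀ {Γ} → All (Term Sg) Γ → All ⟦_⟧ˢ Γ
    ⟦ [] ⟧ᵗˢ     = []
    ⟦ t ∷ ts ⟧ᵗˢ = ⟦ t ⟧ᵗ ∷ ⟦ ts ⟧ᵗˢ

  ⟦_⟧ᵃ : Atom Sg → Bool
  ⟦ rel r ts ⟧ᵃ    = ⟦rel⟧ r ⟦ ts ⟧ᵗˢ
  ⟦ _≐_ {σ} t u ⟧ᵃ = eqᵇ σ ⟦ t ⟧ᵗ ⟦ u ⟧ᵗ
  ⟦ _≼_ {ν} t u ⟧ᵃ = leᵇ ν ⟦ t ⟧ᵗ ⟦ u ⟧ᵗ

  ⟦_⟧ : Formula Sg → Bool
  ⟦ ⊤ ⟧      = true
  ⟦ ⊥ ⟧      = false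
  ⟦ atom α ⟧ = ⟦ α ⟧ᵃ
  ⟦ ∼ φ ⟧    = Bool.not ⟦ φ ⟧
  ⟦ φ ∧ ψ ⟧  = ⟦ φ ⟧ Bool.∧ ⟦ ψ ⟧
  ⟦ φ ∨ ψ ⟧  = ⟦ φ ⟧ Bool.∨ ⟦ ψ ⟧

infix 2 _⊨_

_⊨_ : ∀ {Sg} → Formula Sg → Formula Sg → Set₁
φ ⊨ ψ = ∀ M → let open Model M in T ⟦ φ ⟧ → T ⟦ ψ ⟧

record IsInterpolant {Sg} (Allowed : Symbol Sg → Set) (A B I : Formula Sg) : Set₁ where
  field
    implied      : A ⊨ I
    inconsistent : B ∧ I ⊨ ⊥
    symbols      : ∀ {s} → s ∈ symb I → Allowed s

-- Keys of the auxiliary term variables.  A mixed equality and its negation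
-- share a variable; a mixed inequality and its negation do not.
data Key (Sg : Signature) : Sort (U Sg) → Set where
  eq : ∀ {σ} → Term Sg σ → Term Sg σ → Key Sg σ
  le : ∀ {ν} → Sign → Term Sg (num ν) → Term Sg (num ν) → Key Sg (num ν)

keyAtom : ∀ {Sg σ} → Key Sg σ → Atom Sg
keyAtom (eq t u)   = t ≐ u
keyAtom (le _ t u) = t ≼ u

record AuxVars (Sg : Signature) : Set where
  field
    aux  : ∀ {σ} → Key Sg σ → Fun Sg [] σ
    auxP : ∀ {σ} → Term Sg σ → Term Sg σ → Rel Sg []

data SharedRule : Set where
  pudlák mcMillan : SharedRule

sharedA : ∀ {Sg} → SharedRule → Literal Sg → Formula Sg
sharedA pudlák   ℓ = literal ℓ
sharedA mcMillan ℓ = ⊤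

embed : ∀ ν → ℤ → Scalar ν
embed int z = z
embed rat z = z ℚ./ 1

module Interpolation {Sg : Signature} (A B : Formula Sg) where

  Shared AOnly BOnly : Symbol Sg → Set
  Shared s = s ∈ symb A × s ∈ symb B
  AOnly  s = s ∈ symb A × s ∉ symb B
  BOnly  s = s ∈ symb B × s ∉ symb A

  -- Predicates on terms and literals, applied to their lists of symbols.
  ALocal BLocal AllShared Mixed : List (Symbol Sg) → Set
  ALocal    ss = Any AOnly ss × ¬ Any BOnly ss
  BLocal    ss = Any BOnly ss × ¬ Any AOnly ss
  AllShared ss = All Shared ss
  Mixed     ss = Any AOnly ss × Any BOnly ss

  data LinComb (P : Symbol Sg → Set) {ν} : Term Sg (num ν) → Set where
    vbl : ∀ {x} → P (funSym x) → LinComb P (var x)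
    _·_ : ∀ c {t} → LinComb P t → LinComb P (c · t)
    _⊕_ : ∀ {t u} → LinComb P t → LinComb P u → LinComb P (t ⊕ u)

  -- A mixed equality is written with its A-local side on the left.  `Mixed`
  -- in mixed-≼ says that b contains a B-local variable (a contains an A-local
  -- one anyway).
  data Projectable : Atom Sg → Set where
    a-local : ∀ {α} → ALocal (symbᵃ α) → Projectable α
    b-local : ∀ {α} → BLocal (symbᵃ α) → Projectable α
    shared  : ∀ {α} → AllShared (symbᵃ α) → Projectable α
    mixed-≐ : ∀ {σ} {a b : Term Sg σ} →
              ALocal (symbᵗ a) → BLocal (symbᵗ b) → Projectable (a ≐ b)
    mixed-≼ : ∀ {ν} {a b : Term Sg (num ν)} {c : Scalar ν} →
              LinComb AOnly a → LinComb (λ s → BOnly s ⊎ Shared s) b →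
              Mixed (symbᵃ (a ⊕ b ≼ const c)) → Projectable (a ⊕ b ≼ const c)

  Projections : Clause Sg → Set
  Projections = All (λ ℓ → Projectable (proj₂ ℓ))

  -- Distinctness and freshness of the auxiliary variables of the mixed atoms
  -- among αs.
  record ValidAux (X : AuxVars Sg) (αs : List (Atom Sg)) : Set where
    open AuxVars X

    MixedIn : Atom Sg → Set
    MixedIn α = α ∈ αs × Mixed (symbᵃ α)

    Fresh : Symbol Sg → Set
    Fresh s = s ∉ symb A × s ∉ symb B × (∀ {α} → α ∈ αs → s ∉ symbᵃ α)

    field
      aux-injective  : ∀ {σ} {i j : Key Sg σ} →
                       MixedIn (keyAtom i) → MixedIn (keyAtom j) →
                       aux i ≡ aux j → i ≡ j
      auxP-injective : ∀ {σ τ} {a b : Term Sg σ} {a′ b′ : Term Sg τ} →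
                       MixedIn (a ≐ b) → MixedIn (a′ ≐ b′) →
                       auxP a b ≡ auxP a′ b′ → (a ≐ b) ≡ (a′ ≐ b′)
      aux-fresh      : ∀ {σ} {i : Key Sg σ} →
                       MixedIn (keyAtom i) → Fresh (funSym (aux i))
      auxP-fresh     : ∀ {σ} {a b : Term Sg σ} →
                       MixedIn (a ≐ b) → Fresh (relSym (auxP a b))

  module Projection (X : AuxVars Sg) (rule : SharedRule) where
    open AuxVars X

    EQ⟨_,_⟩ : ∀ {σ} → Term Sg σ → Term Sg σ → Term Sg σ → Formula Sg
    EQ⟨ a , b ⟩ s = atom (rel (auxP a b) []) xor atom (var (aux (eq a b)) ≐ s)

    neg1 : ∀ {ν} → Scalar ν
    neg1 = embed _ -1ℤ

    zero : ∀ {ν} → Term Sg (num ν)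
    zero = const (embed _ 0ℤ)

    -- The negation of u ≤ c is - u ≤ - c - 1 over ℤ and - u < - c over ℚ, so
    -- it has the form a + b ≤ c again, with a strict bound in the case of ℚ.
    -- This bounds t, a term for - u.
    negBound : ∀ {ν} → Term Sg (num ν) → Scalar ν → Formula Sg
    negBound {int} t c = atom (t ≼ const (ℤ.- c ℤ.- 1ℤ))
    negBound {rat} t c = ∼ atom (const (ℚ.- c) ≼ t)

    projA : (ℓ : Literal Sg) → Projectable (proj₂ ℓ) → Formula Sg
    projA ℓ (a-local _) = literal ℓ
    projA ℓ (b-local _) = ⊤
    projA ℓ (shared _)  = sharedA rule ℓ
    projA (pos _) (mixed-≐ {a = a} {b} _ _) = atom (a ≐ var (aux (eq a b)))
    projA (neg _) (mixed-≐ {a = a} {b} _ _) =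
      atom (rel (auxP a b) []) xor atom (a ≐ var (aux (eq a b)))
    projA (pos (l ≼ r)) (mixed-≼ {a = a} _ _ _) =
      atom (a ⊕ var (aux (le Sign.+ l r)) ≼ zero)
    projA (neg (l ≼ r)) (mixed-≼ {a = a} _ _ _) =
      atom (neg1 · a ⊕ var (aux (le Sign.- l r)) ≼ zero)

    projB : (ℓ : Literal Sg) → Projectable (proj₂ ℓ) → Formula Sg
    projB ℓ (a-local _) = ⊤
    projB ℓ (b-local _) = literal ℓ
    projB ℓ (shared _)  = literal ℓ
    projB (pos _) (mixed-≐ {a = a} {b} _ _) = atom (var (aux (eq a b)) ≐ b)
    projB (neg _) (mixed-≐ {a = a} {b} _ _) =
      ∼ atom (rel (auxP a b) []) xor atom (var (aux (eq a b)) ≐ b)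
    projB (pos (l ≼ r)) (mixed-≼ {b = b} {c} _ _ _) =
      atom (neg1 · var (aux (le Sign.+ l r)) ⊕ b ≼ const c)
    projB (neg (l ≼ r)) (mixed-≼ {b = b} {c} _ _ _) =
      negBound (neg1 · var (aux (le Sign.- l r)) ⊕ neg1 · b) c

    auxOf : (ℓ : Literal Sg) → Projectable (proj₂ ℓ) → List (Symbol Sg)
    auxOf _ (a-local _) = []
    auxOf _ (b-local _) = []
    auxOf _ (shared _)  = []
    auxOf (pos _) (mixed-≐ {a = a} {b} _ _) = [ funSym (aux (eq a b)) ]
    auxOf (neg _) (mixed-≐ {a = a} {b} _ _) =
      funSym (aux (eq a b)) ∷ relSym (auxP a b) ∷ []
    auxOf (ς , (l ≼ r)) (mixed-≼ _ _ _) = [ funSym (aux (le ς l r)) ]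

    negate : Literal Sg → Literal Sg
    negate (ς , α) = (opposite ς , α)

    ¬C↓A ¬C↓B : (C : Clause Sg) → Projections C → Formula Sg
    ¬C↓A []      []       = ⊤
    ¬C↓A (ℓ ∷ C) (π ∷ πs) = projA (negate ℓ) π ∧ ¬C↓A C πs
    ¬C↓B []      []       = ⊤
    ¬C↓B (ℓ ∷ C) (π ∷ πs) = projB (negate ℓ) π ∧ ¬C↓B C πs

    aux¬C : (C : Clause Sg) → Projections C → List (Symbol Sg)
    aux¬C []      []       = []
    aux¬C (ℓ ∷ C) (π ∷ πs) = auxOf (negate ℓ) π ++ aux¬C C πs

    PartialInterpolant : (C : Clause Sg) → Projections C → Formula Sg → Set₁
    PartialInterpolant C π =
      IsInterpolant (λ s → Shared s ⊎ s ∈ aux¬C C π) (A ∧ ¬C↓A C π) (B ∧ ¬C↓B C π)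

-- Since x and p are fresh, a model M of A ∧ ¬C₁↓A ∧ ¬C₂↓A stays one when they
-- are reinterpreted.  With x := a and p := ⊥ the projection of a ≠ b to A holds
-- and EQ(x, s) says a = s, in which case I₂(x) is I₂(s); so I₁[EQ(x, sᵢ)] gives
-- I₁[I₂(sᵢ)] by monotonicity.  Dually, on the B side I₂(s) excludes s = b in M;
-- with x := b and p := ⊤ the projection of a ≠ b to B holds and EQ(x, s) says
-- b ≠ s, so I₁[I₂(sᵢ)] gives I₁[EQ(x, sᵢ)].
module Submission where

open import Defs
open import Data.Bool using (Bool; true; false; T; not)
import Data.Bool as Bool
open import Data.Bool.Properties using (T-∧; T-∨; ∨-identityʳ)
open import Data.Fin using (Fin)
import Data.Integer as ℤ
open import Data.List using (List; []; _∷_; _++_; map)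
open import Data.List.Membership.Propositional using (_∈_; _∉_)
open import Data.List.Membership.Propositional.Properties
  using (∈-++⁺ˡ; ∈-++⁺ʳ; ∈-++⁻; ∈-map⁻)
open import Data.List.Relation.Binary.Subset.Propositional using (_⊆_)
import Data.List.Relation.Binary.Subset.Propositional.Properties as ⊆
open import Data.List.Relation.Unary.All using (All; []; _∷_)
open import Data.List.Relation.Unary.All.Properties using (++⁺)
open import Data.List.Relation.Unary.Any using (here; there)
import Data.List.Relation.Unary.Any.Properties as Any
open import Data.Nat using (ℕ)
open import Data.Product using (∃; _×_; _,_; proj₁; proj₂; map₁; map₂)
import Data.Product as Product
import Data.Rational as ℚ
open import Data.Sum using (_⊎_; inj₁; inj₂; [_,_]′)
import Data.Sum as Sum
open import Function using (_∘_; id)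
open import Function.Bundles using (Equivalence)
open import Relation.Binary.PropositionalEquality
  using (_≡_; _≢_; refl; sym; trans; cong; cong₂)
import Relation.Binary.PropositionalEquality as ≡
open import Relation.Nullary using (¬_; Dec; yes; no; does; contradiction)
open import Relation.Nullary.Decidable using (dec-true)

open Equivalence using (to; from)

T-does⁺ : ∀ {P : Set} (P? : Dec P) → P → T (does P?)
T-does⁺ P? p rewrite dec-true P? p = _

T-does⁻ : ∀ {P : Set} (P? : Dec P) → T (does P?) → P
T-does⁻ (yes p) _ = p

¬T⇒T-not : ∀ b → ¬ T b → T (not b)
¬T⇒T-not true  ¬t = ¬t _
¬T⇒T-not false _  = _

funSym-sort : ∀ {Sg : Signature} {Γ Δ σ τ} {f : Signature.Fun Sg Γ σ} {g : Signature.Fun Sg Δ τ} →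
              funSym {Sg} f ≡ funSym g → σ ≡ τ
funSym-sort refl = refl

funSym-injective : ∀ {Sg : Signature} {Γ σ} {f g : Signature.Fun Sg Γ σ} →
                   funSym {Sg} f ≡ funSym g → f ≡ g
funSym-injective refl = refl

relSym-injective : ∀ {Sg : Signature} {Γ} {r q : Signature.Rel Sg Γ} →
                   relSym {Sg} r ≡ relSym q → r ≡ q
relSym-injective refl = refl

infix 2 _⊩_

_⊩_ : ∀ {Sg} → Model Sg → Formula Sg → Set
M ⊩ φ = T (Model.⟦_⟧ M φ)

module _ {Sg : Signature} (M : Model Sg) where
  open Model M

  ≐⁺ : ∀ {σ} (t u : Term Sg σ) → ⟦ t ⟧ᵗ ≡ ⟦ u ⟧ᵗ → T ⟦ atom (t ≐ u) ⟧
  ≐⁺ {num int}   t u = T-does⁺ (⟦ t ⟧ᵗ ℤ.≟ ⟦ u ⟧ᵗ)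
  ≐⁺ {num rat}   t u = T-does⁺ (⟦ t ⟧ᵗ ℚ.≟ ⟦ u ⟧ᵗ)
  ≐⁺ {uninter _} t u = T-does⁺ (⟦ t ⟧ᵗ ≟ ⟦ u ⟧ᵗ)

  ≐⁻ : ∀ {σ} (t u : Term Sg σ) → T ⟦ atom (t ≐ u) ⟧ → ⟦ t ⟧ᵗ ≡ ⟦ u ⟧ᵗ
  ≐⁻ {num int}   t u = T-does⁻ (⟦ t ⟧ᵗ ℤ.≟ ⟦ u ⟧ᵗ)
  ≐⁻ {num rat}   t u = T-does⁻ (⟦ t ⟧ᵗ ℚ.≟ ⟦ u ⟧ᵗ)
  ≐⁻ {uninter _} t u = T-does⁻ (⟦ t ⟧ᵗ ≟ ⟦ u ⟧ᵗ)

  insert-∧ : ∀ φ χ ψ → T ⟦ φ ∧ ψ ⟧ → T ⟦ χ ⟧ → T ⟦ φ ∧ χ ∧ ψ ⟧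
  insert-∧ φ χ ψ φ∧ψ χ-holds with to (T-∧ {⟦ φ ⟧}) φ∧ψ
  ... | φ-holds , ψ-holds = from T-∧ (φ-holds , from (T-∧ {⟦ χ ⟧}) (χ-holds , ψ-holds))

  ⟦xor⟧-falseˡ : ∀ {φ} ψ → ⟦ φ ⟧ ≡ false → ⟦ φ xor ψ ⟧ ≡ ⟦ ψ ⟧
  ⟦xor⟧-falseˡ ψ φ≡false rewrite φ≡false = refl

  ⟦xor⟧-trueˡ : ∀ {φ} ψ → ⟦ φ ⟧ ≡ true → ⟦ φ xor ψ ⟧ ≡ not ⟦ ψ ⟧
  ⟦xor⟧-trueˡ ψ φ≡true rewrite φ≡true = ∨-identityʳ _

module Coincidence {Sg : Signature} (M : Model Sg)
  (fun′ : ∀ {Γ σ} → Signature.Fun Sg Γ σ → All (Model.⟦_⟧ˢ M) Γ → Model.⟦_⟧ˢ M σ)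
  (rel′ : ∀ {Γ} → Signature.Rel Sg Γ → All (Model.⟦_⟧ˢ M) Γ → Bool) where

  open Model M

  M′ : Model Sg
  M′ = record { Carrier = Carrier ; _≟_ = _≟_ ; point = point ; ⟦fun⟧ = fun′ ; ⟦rel⟧ = rel′ }

  module M′ = Model M′

  Agrees : Symbol Sg → Set
  Agrees (funSym f) = ∀ vs → fun′ f vs ≡ ⟦fun⟧ f vs
  Agrees (relSym r) = ∀ vs → rel′ r vs ≡ ⟦rel⟧ r vs

  eqᵇ-reduct : ∀ σ v w → M′.eqᵇ σ v w ≡ eqᵇ σ v w
  eqᵇ-reduct (num int)   v w = refl
  eqᵇ-reduct (num rat)   v w = refl
  eqᵇ-reduct (uninter _) v w = refl

  mutual
    coincidenceᵗ : ∀ {σ} (t : Term Sg σ) → (∀ {s} → s ∈ symbᵗ t → Agrees s) →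
                   M′.⟦ t ⟧ᵗ ≡ ⟦ t ⟧ᵗ
    coincidenceᵗ (app f ts) agree =
      trans (agree (here refl) _) (cong (⟦fun⟧ f) (coincidenceᵗˢ ts (agree ∘ there)))
    coincidenceᵗ (const c) agree = refl
    coincidenceᵗ (_⊕_ {ν} t u) agree =
      cong₂ (add ν) (coincidenceᵗ t (agree ∘ ∈-++⁺ˡ)) (coincidenceᵗ u (agree ∘ ∈-++⁺ʳ _))
    coincidenceᵗ (_·_ {ν} c t) agree = cong (mul ν c) (coincidenceᵗ t agree)
    coincidenceᵗ (⌊ t / k ⌋) agree = cong (ℤ._/ℕ k) (coincidenceᵗ t agree)

    coincidenceᵗˢ : ∀ {Γ} (ts : All (Term Sg) Γ) → (∀ {s} → s ∈ symbᵗˢ ts → Agrees s) →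
                    M′.⟦ ts ⟧ᵗˢ ≡ ⟦ ts ⟧ᵗˢ
    coincidenceᵗˢ [] agree = refl
    coincidenceᵗˢ (t ∷ ts) agree =
      cong₂ _∷_ (coincidenceᵗ t (agree ∘ ∈-++⁺ˡ)) (coincidenceᵗˢ ts (agree ∘ ∈-++⁺ʳ _))

  coincidence : ∀ φ → (∀ {s} → s ∈ symb φ → Agrees s) → M′.⟦ φ ⟧ ≡ ⟦ φ ⟧
  coincidence ⊤ agree = refl
  coincidence ⊥ agree = refl
  coincidence (atom (rel r ts)) agree =
    trans (agree (here refl) _) (cong (⟦rel⟧ r) (coincidenceᵗˢ ts (agree ∘ there)))
  coincidence (atom (_≐_ {σ} t u)) agree =
    trans (cong₂ (M′.eqᵇ σ) (coincidenceᵗ t (agree ∘ ∈-++⁺ˡ)) (coincidenceᵗ u (agree ∘ ∈-++⁺ʳ _)))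
          (eqᵇ-reduct σ _ _)
  coincidence (atom (_≼_ {ν} t u)) agree =
    cong₂ (leᵇ ν) (coincidenceᵗ t (agree ∘ ∈-++⁺ˡ)) (coincidenceᵗ u (agree ∘ ∈-++⁺ʳ _))
  coincidence (∼ φ) agree = cong not (coincidence φ agree)
  coincidence (φ ∧ ψ) agree =
    cong₂ Bool._∧_ (coincidence φ (agree ∘ ∈-++⁺ˡ)) (coincidence ψ (agree ∘ ∈-++⁺ʳ _))
  coincidence (φ ∨ ψ) agree =
    cong₂ Bool._∨_ (coincidence φ (agree ∘ ∈-++⁺ˡ)) (coincidence ψ (agree ∘ ∈-++⁺ʳ _))

module _ {Sg : Signature} where
  open Signature Sg using (Fun; Rel; _≟ᶠ_; _≟ʳ_)

  mutual
    relSym∉symbᵗ : ∀ {Γ} {r : Rel Γ} {σ} (t : Term Sg σ) → relSym r ∉ symbᵗ t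
    relSym∉symbᵗ (app f ts)  (there r∈) = relSym∉symbᵗˢ ts r∈
    relSym∉symbᵗ (t ⊕ u)     r∈ = [ relSym∉symbᵗ t , relSym∉symbᵗ u ]′ (∈-++⁻ (symbᵗ t) r∈)
    relSym∉symbᵗ (_ · t)     r∈ = relSym∉symbᵗ t r∈
    relSym∉symbᵗ (⌊ t / _ ⌋) r∈ = relSym∉symbᵗ t r∈

    relSym∉symbᵗˢ : ∀ {Γ} {r : Rel Γ} {Δ} (ts : All (Term Sg) Δ) → relSym r ∉ symbᵗˢ ts
    relSym∉symbᵗˢ (t ∷ ts) r∈ = [ relSym∉symbᵗ t , relSym∉symbᵗˢ ts ]′ (∈-++⁻ (symbᵗ t) r∈)

  module _ (M : Model Sg) where
    open Model M

    assignFun : ∀ {τ} → Fun [] τ → ⟦ τ ⟧ˢ →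
                ∀ {Γ σ} → Fun Γ σ → All ⟦_⟧ˢ Γ → ⟦ σ ⟧ˢ
    assignFun {τ} x v {Γ} {σ} f vs with (Γ , σ , f) ≟ᶠ ([] , τ , x)
    ... | yes refl = v
    ... | no  _    = ⟦fun⟧ f vs

    assignFun-same : ∀ {τ} (x : Fun [] τ) v → assignFun x v x [] ≡ v
    assignFun-same {τ} x v with ([] , τ , x) ≟ᶠ ([] , τ , x)
    ... | yes refl = refl
    ... | no  x≢x  = contradiction refl x≢x

    assignFun-other : ∀ {τ} (x : Fun [] τ) v {Γ σ} (f : Fun Γ σ) →
                      funSym {Sg} f ≢ funSym x → ∀ vs → assignFun x v f vs ≡ ⟦fun⟧ f vs
    assignFun-other {τ} x v {Γ} {σ} f f≢x vs with (Γ , σ , f) ≟ᶠ ([] , τ , x)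
    ... | yes refl = contradiction refl f≢x
    ... | no  _    = refl

    assignRel : Rel [] → Bool → ∀ {Γ} → Rel Γ → All ⟦_⟧ˢ Γ → Bool
    assignRel p β {Γ} r vs with (Γ , r) ≟ʳ ([] , p)
    ... | yes _ = β
    ... | no  _ = ⟦rel⟧ r vs

    assignRel-same : ∀ (p : Rel []) β → assignRel p β p [] ≡ β
    assignRel-same p β with ([] , p) ≟ʳ ([] , p)
    ... | yes _   = refl
    ... | no  p≢p = contradiction refl p≢p

    assignRel-other : ∀ (p : Rel []) β {Γ} (r : Rel Γ) →
                      relSym {Sg} r ≢ relSym p → ∀ vs → assignRel p β r vs ≡ ⟦rel⟧ r vs
    assignRel-other p β {Γ} r r≢p vs with (Γ , r) ≟ʳ ([] , p)
    ... | yes refl = contradiction refl r≢p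
    ... | no  _    = refl

  module AssignVar (M : Model Sg) {τ} (x : Fun [] τ) (v : Model.⟦_⟧ˢ M τ) where
    open Coincidence M (assignFun M x v) (Model.⟦rel⟧ M) public

    agrees : ∀ {s} → s ≢ funSym x → Agrees s
    agrees {funSym f} s≢x = assignFun-other M x v f s≢x
    agrees {relSym r} _   = λ _ → refl

    unaffectedᵗ : ∀ {σ} (t : Term Sg σ) → funSym x ∉ symbᵗ t → M′.⟦ t ⟧ᵗ ≡ Model.⟦_⟧ᵗ M t
    unaffectedᵗ t x∉t = coincidenceᵗ t λ { s∈t → agrees λ { refl → x∉t s∈t } }

    unaffected : ∀ φ → funSym x ∉ symb φ → M′.⟦ φ ⟧ ≡ Model.⟦_⟧ M φ
    unaffected φ x∉φ = coincidence φ λ { s∈φ → agrees λ { refl → x∉φ s∈φ } }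

    ⟦var⟧ : M′.⟦ var x ⟧ᵗ ≡ v
    ⟦var⟧ = assignFun-same M x v

  module AssignProp (M : Model Sg) (p : Rel []) (β : Bool) where
    open Coincidence M (Model.⟦fun⟧ M) (assignRel M p β) public

    agrees : ∀ {s} → s ≢ relSym p → Agrees s
    agrees {funSym f} _   = λ _ → refl
    agrees {relSym r} s≢p = assignRel-other M p β r s≢p

    unaffectedᵗ : ∀ {σ} (t : Term Sg σ) → M′.⟦ t ⟧ᵗ ≡ Model.⟦_⟧ᵗ M t
    unaffectedᵗ t = coincidenceᵗ t λ { s∈t → agrees λ { refl → relSym∉symbᵗ t s∈t } }

    unaffected : ∀ φ → relSym p ∉ symb φ → M′.⟦ φ ⟧ ≡ Model.⟦_⟧ M φ
    unaffected φ p∉φ = coincidence φ λ { s∈φ → agrees λ { refl → p∉φ s∈φ } }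

    ⟦prop⟧ : M′.⟦ atom (rel p []) ⟧ ≡ β
    ⟦prop⟧ = assignRel-same M p β

  module Substitution (M : Model Sg) {τ} (x : Fun [] τ) (s : Term Sg τ) where
    open Model M
    open AssignVar M x ⟦ s ⟧ᵗ using (M′; module M′; eqᵇ-reduct)

    mutual
      substitutionᵗ : ∀ {σ} (t : Term Sg σ) → ⟦ substᵗ x s t ⟧ᵗ ≡ M′.⟦ t ⟧ᵗ
      substitutionᵗ (app {Γ} {σ} f ts) with (Γ , σ , f) ≟ᶠ ([] , τ , x)
      ... | yes refl = refl
      ... | no  _    = cong (⟦fun⟧ f) (substitutionᵗˢ ts)
      substitutionᵗ (const c) = refl
      substitutionᵗ (_⊕_ {ν} t u) = cong₂ (add ν) (substitutionᵗ t) (substitutionᵗ u)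
      substitutionᵗ (_·_ {ν} c t) = cong (mul ν c) (substitutionᵗ t)
      substitutionᵗ (⌊ t / k ⌋) = cong (ℤ._/ℕ k) (substitutionᵗ t)

      substitutionᵗˢ : ∀ {Γ} (ts : All (Term Sg) Γ) → ⟦ substᵗˢ x s ts ⟧ᵗˢ ≡ M′.⟦ ts ⟧ᵗˢ
      substitutionᵗˢ []       = refl
      substitutionᵗˢ (t ∷ ts) = cong₂ _∷_ (substitutionᵗ t) (substitutionᵗˢ ts)

    substitution : ∀ φ → ⟦ subst x s φ ⟧ ≡ M′.⟦ φ ⟧
    substitution ⊤ = refl
    substitution ⊥ = refl
    substitution (atom (rel r ts)) = cong (⟦rel⟧ r) (substitutionᵗˢ ts)
    substitution (atom (_≐_ {σ} t u)) =
      trans (cong₂ (eqᵇ σ) (substitutionᵗ t) (substitutionᵗ u)) (sym (eqᵇ-reduct σ _ _))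
    substitution (atom (_≼_ {ν} t u)) = cong₂ (leᵇ ν) (substitutionᵗ t) (substitutionᵗ u)
    substitution (∼ φ)   = cong not (substitution φ)
    substitution (φ ∧ ψ) = cong₂ Bool._∧_ (substitution φ) (substitution ψ)
    substitution (φ ∨ ψ) = cong₂ Bool._∨_ (substitution φ) (substitution ψ)

  map-∈-++ : ∀ {zs zs′ ys ys′ : List (Symbol Sg)} {P Q : Set} {z} →
             (z ∈ zs → P ⊎ (z ∈ ys × Q)) → (z ∈ zs′ → P ⊎ (z ∈ ys′ × Q)) →
             z ∈ zs ++ zs′ → P ⊎ (z ∈ ys ++ ys′ × Q)
  map-∈-++ {zs} h h′ z∈ =
    [ Sum.map₂ (map₁ ∈-++⁺ˡ) ∘ h , Sum.map₂ (map₁ (∈-++⁺ʳ _)) ∘ h′ ]′ (∈-++⁻ zs z∈)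

  module _ {τ} (x : Fun [] τ) (s : Term Sg τ) where

    mutual
      symbᵗ-subst : ∀ {σ} (t : Term Sg σ) {z} → z ∈ symbᵗ (substᵗ x s t) →
                    z ∈ symbᵗ s ⊎ (z ∈ symbᵗ t × z ≢ funSym x)
      symbᵗ-subst (app {Γ} {σ} f ts) z∈ with (Γ , σ , f) ≟ᶠ ([] , τ , x) | z∈
      ... | yes refl | z∈s        = inj₁ z∈s
      ... | no f≢x   | here refl  = inj₂ (here refl , λ { refl → f≢x refl })
      ... | no _     | there z∈ts = Sum.map₂ (map₁ there) (symbᵗˢ-subst ts z∈ts)
      symbᵗ-subst (t ⊕ u)     z∈ = map-∈-++ (symbᵗ-subst t) (symbᵗ-subst u) z∈
      symbᵗ-subst (_ · t)     z∈ = symbᵗ-subst t z∈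
      symbᵗ-subst (⌊ t / _ ⌋) z∈ = symbᵗ-subst t z∈

      symbᵗˢ-subst : ∀ {Γ} (ts : All (Term Sg) Γ) {z} → z ∈ symbᵗˢ (substᵗˢ x s ts) →
                     z ∈ symbᵗ s ⊎ (z ∈ symbᵗˢ ts × z ≢ funSym x)
      symbᵗˢ-subst (t ∷ ts) z∈ = map-∈-++ (symbᵗ-subst t) (symbᵗˢ-subst ts) z∈

    symb-subst : ∀ φ {z} → z ∈ symb (subst x s φ) →
                 z ∈ symbᵗ s ⊎ (z ∈ symb φ × z ≢ funSym x)
    symb-subst (atom (rel r ts)) (here refl) = inj₂ (here refl , λ ())
    symb-subst (atom (rel r ts)) (there z∈)  = Sum.map₂ (map₁ there) (symbᵗˢ-subst ts z∈)
    symb-subst (atom (t ≐ u)) z∈ = map-∈-++ (symbᵗ-subst t) (symbᵗ-subst u) z∈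
    symb-subst (atom (t ≼ u)) z∈ = map-∈-++ (symbᵗ-subst t) (symbᵗ-subst u) z∈
    symb-subst (∼ φ)   z∈ = symb-subst φ z∈
    symb-subst (φ ∧ ψ) z∈ = map-∈-++ (symb-subst φ) (symb-subst ψ) z∈
    symb-subst (φ ∨ ψ) z∈ = map-∈-++ (symb-subst φ) (symb-subst ψ) z∈

  module _ {n : ℕ} where

    symb-skeleton⊆ : ∀ (F : NNF Sg n) G → symb (fill F (λ _ → ⊤)) ⊆ symb (fill F G)
    symb-skeleton⊆ (lit ℓ)  G = id
    symb-skeleton⊆ (F ∧ F′) G = ⊆.++⁺ (symb-skeleton⊆ F G) (symb-skeleton⊆ F′ G)
    symb-skeleton⊆ (F ∨ F′) G = ⊆.++⁺ (symb-skeleton⊆ F G) (symb-skeleton⊆ F′ G)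

    _occursIn_ : Fin n → NNF Sg n → Set
    i occursIn F = ∀ G → symb (G i) ⊆ symb (fill F G)

    symb-fill : ∀ (F : NNF Sg n) G {z} → z ∈ symb (fill F G) →
                z ∈ symb (fill F (λ _ → ⊤)) ⊎ ∃ λ i → i occursIn F × z ∈ symb (G i)
    symb-fill (hole i) G z∈ = inj₂ (i , (λ _ → id) , z∈)
    symb-fill (lit ℓ)  G z∈ = inj₁ z∈
    symb-fill (F ∧ F′) G z∈ with ∈-++⁻ (symb (fill F G)) z∈
    ... | inj₁ z∈F = Sum.map ∈-++⁺ˡ (map₂ (map₁ λ i∈F G′ → ∈-++⁺ˡ ∘ i∈F G′)) (symb-fill F G z∈F)
    ... | inj₂ z∈F′ =
      Sum.map (∈-++⁺ʳ _) (map₂ (map₁ λ i∈F′ G′ → ∈-++⁺ʳ _ ∘ i∈F′ G′)) (symb-fill F′ G z∈F′)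
    symb-fill (F ∨ F′) G z∈ with ∈-++⁻ (symb (fill F G)) z∈
    ... | inj₁ z∈F = Sum.map ∈-++⁺ˡ (map₂ (map₁ λ i∈F G′ → ∈-++⁺ˡ ∘ i∈F G′)) (symb-fill F G z∈F)
    ... | inj₂ z∈F′ =
      Sum.map (∈-++⁺ʳ _) (map₂ (map₁ λ i∈F′ G′ → ∈-++⁺ʳ _ ∘ i∈F′ G′)) (symb-fill F′ G z∈F′)

    fill-mono : ∀ (M N : Model Sg) (F : NNF Sg n) {G H} →
                (∀ φ → symb φ ⊆ symb (fill F (λ _ → ⊤)) → Model.⟦_⟧ M φ ≡ Model.⟦_⟧ N φ) →
                (∀ i → M ⊩ G i → N ⊩ H i) →
                M ⊩ fill F G → N ⊩ fill F H
    fill-mono M N (hole i) M≈N G⇒H = G⇒H i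
    fill-mono M N (lit ℓ)  M≈N G⇒H = ≡.subst T (M≈N (literal ℓ) id)
    fill-mono M N ⊤        M≈N G⇒H = id
    fill-mono M N (F ∧ F′) M≈N G⇒H =
      from T-∧ ∘
      Product.map (fill-mono M N F (λ φ φ⊆ → M≈N φ (∈-++⁺ˡ ∘ φ⊆)) G⇒H)
                  (fill-mono M N F′ (λ φ φ⊆ → M≈N φ (∈-++⁺ʳ _ ∘ φ⊆)) G⇒H) ∘
      to T-∧
    fill-mono M N (F ∨ F′) M≈N G⇒H =
      from T-∨ ∘
      Sum.map (fill-mono M N F (λ φ φ⊆ → M≈N φ (∈-++⁺ˡ ∘ φ⊆)) G⇒H)
              (fill-mono M N F′ (λ φ φ⊆ → M≈N φ (∈-++⁺ʳ _ ∘ φ⊆)) G⇒H) ∘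
      to T-∨

  module Resolution {τ} (x : Fun [] τ) (p : Rel []) {n : ℕ} (F : NNF Sg n) (s : Fin n → Term Sg τ)
    (x∉F : funSym x ∉ symb (fill F (λ _ → ⊤))) (p∉F : relSym p ∉ symb (fill F (λ _ → ⊤)))
    (x∉s : ∀ i → funSym x ∉ symbᵗ (s i)) (I : Formula Sg) (φ₁ φ₂ : Formula Sg)
    (x∉φ₁ : funSym x ∉ symb φ₁) (p∉φ₁ : relSym p ∉ symb φ₁) (x∉φ₂ : funSym x ∉ symb φ₂) where

    EQ : Term Sg τ → Formula Sg
    EQ t = atom (rel p []) xor atom (var x ≐ t)

    module _ (M : Model Sg) (c : Term Sg τ) (x∉c : funSym x ∉ symbᵗ c) (β : Bool) where
      open Model M
      private
        module M₁ = AssignVar M x ⟦ c ⟧ᵗ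
        module M₂ = AssignProp M₁.M′ p β

      unaffected₁₂ : ∀ φ → funSym x ∉ symb φ → relSym p ∉ symb φ → M₂.M′.⟦ φ ⟧ ≡ ⟦ φ ⟧
      unaffected₁₂ φ x∉φ p∉φ = trans (M₂.unaffected φ p∉φ) (M₁.unaffected φ x∉φ)

      unaffected₁₂ᵗ : ∀ {σ} (t : Term Sg σ) → funSym x ∉ symbᵗ t → M₂.M′.⟦ t ⟧ᵗ ≡ ⟦ t ⟧ᵗ
      unaffected₁₂ᵗ t x∉t = trans (M₂.unaffectedᵗ t) (M₁.unaffectedᵗ t x∉t)

      x≡c : M₂.M′.⟦ var x ⟧ᵗ ≡ M₂.M′.⟦ c ⟧ᵗ
      x≡c = trans (M₂.unaffectedᵗ (var x)) (trans M₁.⟦var⟧ (sym (unaffected₁₂ᵗ c x∉c)))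

      x≐s⁻ : ∀ i → T M₂.M′.⟦ atom (var x ≐ s i) ⟧ → ⟦ s i ⟧ᵗ ≡ ⟦ c ⟧ᵗ
      x≐s⁻ i x≐sᵢ =
        trans (sym (unaffected₁₂ᵗ (s i) (x∉s i)))
          (trans (sym (≐⁻ M₂.M′ (var x) (s i) x≐sᵢ)) (trans x≡c (unaffected₁₂ᵗ c x∉c)))

    module _ (a : Term Sg τ) (x∉a : funSym x ∉ symbᵗ a)
      (F-implied : ∀ M → M ⊩ φ₁ → M ⊩ atom (rel p []) xor atom (a ≐ var x) →
                   M ⊩ fill F (λ i → EQ (s i)))
      (I-implied : ∀ M → M ⊩ φ₂ → M ⊩ atom (a ≐ var x) → M ⊩ I) where

      resolvent-implied : ∀ M → M ⊩ φ₁ → M ⊩ φ₂ → M ⊩ fill F (λ i → subst x (s i) I)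
      resolvent-implied M φ₁-holds φ₂-holds =
        fill-mono M₂.M′ M F
          (λ φ φ⊆F → unaffected₁₂ M a x∉a false φ (x∉F ∘ φ⊆F) (p∉F ∘ φ⊆F))
          EQ⇒I
          (F-implied M₂.M′
            (≡.subst T (sym (unaffected₁₂ M a x∉a false φ₁ x∉φ₁ p∉φ₁)) φ₁-holds)
            (≡.subst T (sym (⟦xor⟧-falseˡ M₂.M′ {atom (rel p [])} (atom (a ≐ var x)) M₂.⟦prop⟧))
              (≐⁺ M₂.M′ a (var x) (sym (x≡c M a x∉a false)))))
        where
        open Model M
        module M₁ = AssignVar M x ⟦ a ⟧ᵗ
        module M₂ = AssignProp M₁.M′ p false

        I-holds : T M₁.M′.⟦ I ⟧
        I-holds = I-implied M₁.M′
          (≡.subst T (sym (M₁.unaffected φ₂ x∉φ₂)) φ₂-holds)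
          (≐⁺ M₁.M′ a (var x) (trans (M₁.unaffectedᵗ a x∉a) (sym M₁.⟦var⟧)))

        EQ⇒I : ∀ i → T M₂.M′.⟦ EQ (s i) ⟧ → T ⟦ subst x (s i) I ⟧
        EQ⇒I i EQᵢ = ≡.subst T (sym (Substitution.substitution M x (s i) I))
          (≡.subst (λ v → AssignVar.M′ M x v ⊩ I) (sym sᵢ≡a) I-holds)
          where
          sᵢ≡a : ⟦ s i ⟧ᵗ ≡ ⟦ a ⟧ᵗ
          sᵢ≡a = x≐s⁻ M a x∉a false i
            (≡.subst T (⟦xor⟧-falseˡ M₂.M′ {atom (rel p [])} (atom (var x ≐ s i)) M₂.⟦prop⟧) EQᵢ)

    module _ (b : Term Sg τ) (x∉b : funSym x ∉ symbᵗ b)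
      (F-inconsistent : ∀ M → M ⊩ φ₁ → M ⊩ ∼ atom (rel p []) xor atom (var x ≐ b) →
                        ¬ (M ⊩ fill F (λ i → EQ (s i))))
      (I-inconsistent : ∀ M → M ⊩ φ₂ → M ⊩ atom (var x ≐ b) → ¬ (M ⊩ I)) where

      resolvent-inconsistent : ∀ M → M ⊩ φ₁ → M ⊩ φ₂ → ¬ (M ⊩ fill F (λ i → subst x (s i) I))
      resolvent-inconsistent M φ₁-holds φ₂-holds =
        F-inconsistent M₂.M′
          (≡.subst T (sym (unaffected₁₂ M b x∉b true φ₁ x∉φ₁ p∉φ₁)) φ₁-holds)
          (≡.subst T (sym (⟦xor⟧-falseˡ M₂.M′ {∼ atom (rel p [])} (atom (var x ≐ b))
                                        (cong not M₂.⟦prop⟧)))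
            (≐⁺ M₂.M′ (var x) b (x≡c M b x∉b true)))
        ∘ fill-mono M M₂.M′ F
            (λ φ φ⊆F → sym (unaffected₁₂ M b x∉b true φ (x∉F ∘ φ⊆F) (p∉F ∘ φ⊆F)))
            I⇒EQ
        where
        open Model M
        module M₁ = AssignVar M x ⟦ b ⟧ᵗ
        module M₂ = AssignProp M₁.M′ p true

        I-fails : ¬ T M₁.M′.⟦ I ⟧
        I-fails = I-inconsistent M₁.M′
          (≡.subst T (sym (M₁.unaffected φ₂ x∉φ₂)) φ₂-holds)
          (≐⁺ M₁.M′ (var x) b (trans M₁.⟦var⟧ (sym (M₁.unaffectedᵗ b x∉b))))

        I⇒EQ : ∀ i → T ⟦ subst x (s i) I ⟧ → T M₂.M′.⟦ EQ (s i) ⟧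
        I⇒EQ i Iᵢ =
          ≡.subst T (sym (⟦xor⟧-trueˡ M₂.M′ {atom (rel p [])} (atom (var x ≐ s i)) M₂.⟦prop⟧))
            (¬T⇒T-not _ λ x≐sᵢ → I-fails
              (≡.subst (λ v → AssignVar.M′ M x v ⊩ I) (x≐s⁻ M b x∉b true i x≐sᵢ)
                (≡.subst T (Substitution.substitution M x (s i) I) Iᵢ)))

symb-literal : ∀ {Sg} (ℓ : Literal Sg) → symb (literal ℓ) ⊆ symbᵃ (proj₂ ℓ)
symb-literal (pos _) = id
symb-literal (neg _) = id

symb-sharedA : ∀ {Sg} r (ℓ : Literal Sg) → symb (sharedA r ℓ) ⊆ symbᵃ (proj₂ ℓ)
symb-sharedA pudlák ℓ = symb-literal ℓ

module _ {Sg : Signature} (A B : Formula Sg) (X : AuxVars Sg) (rule : SharedRule) where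
  open Interpolation A B
  open Projection X rule
  open AuxVars X

  data AuxOf : Atom Sg → Symbol Sg → Set where
    aux-var  : ∀ {σ} (i : Key Sg σ) → AuxOf (keyAtom i) (funSym (aux i))
    aux-prop : ∀ {σ} (a b : Term Sg σ) → AuxOf (a ≐ b) (relSym (auxP a b))

  Occurs : Atom Sg → Symbol Sg → Set
  Occurs α z = z ∈ symbᵃ α ⊎ (Mixed (symbᵃ α) × AuxOf α z)

  mixed-symbᵃ : ∀ {σ} (a b : Term Sg σ) → ALocal (symbᵗ a) → BLocal (symbᵗ b) →
                Mixed (symbᵃ (a ≐ b))
  mixed-symbᵃ a b (a∋A , _) (b∋B , _) = Any.++⁺ˡ a∋A , Any.++⁺ʳ (symbᵗ a) b∋B

  symb-projA : ∀ ℓ (π : Projectable (proj₂ ℓ)) {z} → z ∈ symb (projA ℓ π) → Occurs (proj₂ ℓ) z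
  symb-projA ℓ (a-local _) z∈ = inj₁ (symb-literal ℓ z∈)
  symb-projA ℓ (shared _) z∈ = inj₁ (symb-sharedA rule ℓ z∈)
  symb-projA (pos _) (mixed-≐ {a = a} {b} a-loc b-loc) z∈ with ∈-++⁻ (symbᵗ a) z∈
  ... | inj₁ z∈a         = inj₁ (∈-++⁺ˡ z∈a)
  ... | inj₂ (here refl) = inj₂ (mixed-symbᵃ a b a-loc b-loc , aux-var (eq a b))
  symb-projA (neg _) (mixed-≐ {a = a} {b} a-loc b-loc) z∈ =
    [ side , side ]′ (∈-++⁻ (relSym (auxP a b) ∷ symbᵗ a ++ _) z∈)
    where
    side : ∀ {z} → z ∈ relSym (auxP a b) ∷ symbᵗ a ++ funSym (aux (eq a b)) ∷ [] →
           Occurs (a ≐ b) z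
    side (here refl) = inj₂ (mixed-symbᵃ a b a-loc b-loc , aux-prop a b)
    side (there z∈) with ∈-++⁻ (symbᵗ a) z∈
    ... | inj₁ z∈a         = inj₁ (∈-++⁺ˡ z∈a)
    ... | inj₂ (here refl) = inj₂ (mixed-symbᵃ a b a-loc b-loc , aux-var (eq a b))
  symb-projA (pos (l ≼ r)) (mixed-≼ {a = a} _ _ mixed) z∈
    with ∈-++⁻ (symbᵗ a ++ funSym (aux (le _ l r)) ∷ []) z∈
  ... | inj₁ z∈ with ∈-++⁻ (symbᵗ a) z∈
  ...   | inj₁ z∈a         = inj₁ (∈-++⁺ˡ (∈-++⁺ˡ z∈a))
  ...   | inj₂ (here refl) = inj₂ (mixed , aux-var (le _ l r))
  symb-projA (neg (l ≼ r)) (mixed-≼ {a = a} _ _ mixed) z∈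
    with ∈-++⁻ (symbᵗ a ++ funSym (aux (le _ l r)) ∷ []) z∈
  ... | inj₁ z∈ with ∈-++⁻ (symbᵗ a) z∈
  ...   | inj₁ z∈a         = inj₁ (∈-++⁺ˡ (∈-++⁺ˡ z∈a))
  ...   | inj₂ (here refl) = inj₂ (mixed , aux-var (le _ l r))

  symb-negBound : ∀ {ν} (t : Term Sg (num ν)) c {z} → z ∈ symb (negBound t c) → z ∈ symbᵗ t
  symb-negBound {int} t c z∈ = [ id , (λ ()) ]′ (∈-++⁻ (symbᵗ t) z∈)
  symb-negBound {rat} t c z∈ = z∈

  symb-projB : ∀ ℓ (π : Projectable (proj₂ ℓ)) {z} → z ∈ symb (projB ℓ π) → Occurs (proj₂ ℓ) z
  symb-projB ℓ (b-local _) z∈ = inj₁ (symb-literal ℓ z∈)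
  symb-projB ℓ (shared _)  z∈ = inj₁ (symb-literal ℓ z∈)
  symb-projB (pos _) (mixed-≐ {a = a} {b} a-loc b-loc) (here refl) =
    inj₂ (mixed-symbᵃ a b a-loc b-loc , aux-var (eq a b))
  symb-projB (pos _) (mixed-≐ {a = a} {b} a-loc b-loc) (there z∈b) = inj₁ (∈-++⁺ʳ (symbᵗ a) z∈b)
  symb-projB (neg _) (mixed-≐ {a = a} {b} a-loc b-loc) z∈ =
    [ side , side ]′ (∈-++⁻ (relSym (auxP a b) ∷ funSym (aux (eq a b)) ∷ symbᵗ b) z∈)
    where
    side : ∀ {z} → z ∈ relSym (auxP a b) ∷ funSym (aux (eq a b)) ∷ symbᵗ b → Occurs (a ≐ b) z
    side (here refl)         = inj₂ (mixed-symbᵃ a b a-loc b-loc , aux-prop a b)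
    side (there (here refl)) = inj₂ (mixed-symbᵃ a b a-loc b-loc , aux-var (eq a b))
    side (there (there z∈b)) = inj₁ (∈-++⁺ʳ (symbᵗ a) z∈b)
  symb-projB (pos (l ≼ r)) (mixed-≼ _ _ mixed) (here refl) =
    inj₂ (mixed , aux-var (le _ l r))
  symb-projB (pos (l ≼ r)) (mixed-≼ {a = a} {b} _ _ mixed) (there z∈b) =
    inj₁ ([ ∈-++⁺ˡ ∘ ∈-++⁺ʳ (symbᵗ a) , (λ ()) ]′ (∈-++⁻ (symbᵗ b) z∈b))
  symb-projB (neg (l ≼ r)) (mixed-≼ {a = a} {b} {c} _ _ mixed) z∈
    with symb-negBound (neg1 · var (aux (le _ l r)) ⊕ neg1 · b) c z∈
  ... | here refl = inj₂ (mixed , aux-var (le _ l r))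
  ... | there z∈b = inj₁ (∈-++⁺ˡ (∈-++⁺ʳ (symbᵗ a) z∈b))

  OccursIn : Clause Sg → Symbol Sg → Set
  OccursIn C z = ∃ λ α → α ∈ map proj₂ C × Occurs α z

  symb-¬C↓A : ∀ C (π : Projections C) {z} → z ∈ symb (¬C↓A C π) → OccursIn C z
  symb-¬C↓A (ℓ ∷ C) (π ∷ πs) z∈ with ∈-++⁻ (symb (projA (negate ℓ) π)) z∈
  ... | inj₁ z∈ℓ = proj₂ ℓ , here refl , symb-projA (negate ℓ) π z∈ℓ
  ... | inj₂ z∈C = map₂ (map₁ there) (symb-¬C↓A C πs z∈C)

  symb-¬C↓B : ∀ C (π : Projections C) {z} → z ∈ symb (¬C↓B C π) → OccursIn C z
  symb-¬C↓B (ℓ ∷ C) (π ∷ πs) z∈ with ∈-++⁻ (symb (projB (negate ℓ) π)) z∈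
  ... | inj₁ z∈ℓ = proj₂ ℓ , here refl , symb-projB (negate ℓ) π z∈ℓ
  ... | inj₂ z∈C = map₂ (map₁ there) (symb-¬C↓B C πs z∈C)

  ¬C↓A-++⁻ : ∀ M C D (π : Projections C) (ρ : Projections D) →
             M ⊩ ¬C↓A (C ++ D) (++⁺ π ρ) → (M ⊩ ¬C↓A C π) × (M ⊩ ¬C↓A D ρ)
  ¬C↓A-++⁻ M []      D []       ρ ¬D = _ , ¬D
  ¬C↓A-++⁻ M (ℓ ∷ C) D (π ∷ πs) ρ ¬ℓCD with to T-∧ ¬ℓCD
  ... | ¬ℓ , ¬CD = map₁ (λ ¬C → from T-∧ (¬ℓ , ¬C)) (¬C↓A-++⁻ M C D πs ρ ¬CD)

  ¬C↓B-++⁻ : ∀ M C D (π : Projections C) (ρ : Projections D) →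
             M ⊩ ¬C↓B (C ++ D) (++⁺ π ρ) → (M ⊩ ¬C↓B C π) × (M ⊩ ¬C↓B D ρ)
  ¬C↓B-++⁻ M []      D []       ρ ¬D = _ , ¬D
  ¬C↓B-++⁻ M (ℓ ∷ C) D (π ∷ πs) ρ ¬ℓCD with to T-∧ ¬ℓCD
  ... | ¬ℓ , ¬CD = map₁ (λ ¬C → from T-∧ (¬ℓ , ¬C)) (¬C↓B-++⁻ M C D πs ρ ¬CD)

  aux¬C-++⁺ˡ : ∀ C D (π : Projections C) (ρ : Projections D) →
               aux¬C C π ⊆ aux¬C (C ++ D) (++⁺ π ρ)
  aux¬C-++⁺ˡ (ℓ ∷ C) D (π ∷ πs) ρ = ⊆.++⁺ (id {A = _ ∈ auxOf (negate ℓ) π}) (aux¬C-++⁺ˡ C D πs ρ)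

  aux¬C-++⁺ʳ : ∀ C D (π : Projections C) (ρ : Projections D) →
               aux¬C D ρ ⊆ aux¬C (C ++ D) (++⁺ π ρ)
  aux¬C-++⁺ʳ []      D []       ρ = id
  aux¬C-++⁺ʳ (ℓ ∷ C) D (π ∷ πs) ρ = ∈-++⁺ʳ (auxOf (negate ℓ) π) ∘ aux¬C-++⁺ʳ C D πs ρ

  module _ {αs : List (Atom Sg)} (valid : ValidAux X αs) where
    open ValidAux valid

    auxOf-fresh : ∀ {α z} → MixedIn α → AuxOf α z → Fresh z
    auxOf-fresh mixed (aux-var i)    = aux-fresh {i = i} mixed
    auxOf-fresh mixed (aux-prop a b) = auxP-fresh {a = a} {b} mixed

    auxOf-unique : ∀ {α β z z′} → MixedIn α → MixedIn β → AuxOf α z → AuxOf β z′ →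
                   z ≡ z′ → α ≡ β
    auxOf-unique mixed mixed′ (aux-var i) (aux-var j) z≡z′ with funSym-sort z≡z′
    ... | refl = cong keyAtom (aux-injective mixed mixed′ (funSym-injective z≡z′))
    auxOf-unique mixed mixed′ (aux-prop a b) (aux-prop a′ b′) z≡z′ =
      auxP-injective mixed mixed′ (relSym-injective z≡z′)

    auxOf-∉ : ∀ {α z} → MixedIn α → AuxOf α z → ∀ C → map proj₂ C ⊆ αs → α ∉ map proj₂ C →
              ¬ OccursIn C z
    auxOf-∉ mixed z-aux C C⊆αs α∉C (β , β∈C , inj₁ z∈β) =
      proj₂ (proj₂ (auxOf-fresh mixed z-aux)) (C⊆αs β∈C) z∈β
    auxOf-∉ mixed z-aux C C⊆αs α∉C (β , β∈C , inj₂ (β-mixed , z-aux′))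
      with auxOf-unique mixed (C⊆αs β∈C , β-mixed) z-aux z-aux′ refl
    ... | refl = α∉C β∈C

atom∉ : ∀ {Sg} {α : Atom Sg} {C : Clause Sg} → pos α ∉ C → neg α ∉ C → α ∉ map proj₂ C
atom∉ pos∉C neg∉C α∈C with ∈-map⁻ proj₂ α∈C
... | pos _ , ℓ∈C , refl = pos∉C ℓ∈C
... | neg _ , ℓ∈C , refl = neg∉C ℓ∈C

theorem2 :
  (Sg : Signature) (A B : Formula Sg) → A ∧ B ⊨ ⊥ →
  let open Interpolation A B in
  (X : AuxVars Sg) (rule : SharedRule) →
  let open Projection X rule
      open AuxVars X in
  ∀ {σ} (a b : Term Sg σ) (a-loc : ALocal (symbᵗ a)) (b-loc : BLocal (symbᵗ b))
  (C₁ C₂ : Clause Sg) (π₁ : Projections C₁) (π₂ : Projections C₂) →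
  ValidAux X (a ≐ b ∷ map proj₂ (C₁ ++ C₂)) →
  pos (a ≐ b) ∉ C₁ → neg (a ≐ b) ∉ C₁ →
  pos (a ≐ b) ∉ C₂ → neg (a ≐ b) ∉ C₂ →
  let x = aux (eq a b)
      p = auxP a b in
  (n : ℕ) (I₁ : NNF Sg n) (s : Fin n → Term Sg σ) →
  funSym x ∉ symb (fill I₁ (λ _ → ⊤)) →
  relSym p ∉ symb (fill I₁ (λ _ → ⊤)) →
  (∀ i → funSym x ∉ symbᵗ (s i)) →
  PartialInterpolant (pos (a ≐ b) ∷ C₁) (mixed-≐ a-loc b-loc ∷ π₁)
    (fill I₁ (λ i → EQ⟨ a , b ⟩ (s i))) →
  (I₂ : Formula Sg) →
  PartialInterpolant (neg (a ≐ b) ∷ C₂) (mixed-≐ a-loc b-loc ∷ π₂) I₂ →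
  PartialInterpolant (C₁ ++ C₂) (++⁺ π₁ π₂)
    (fill I₁ (λ i → subst x (s i) I₂))
theorem2 Sg A B _ X rule {σ} a b a-loc b-loc C₁ C₂ π₁ π₂ valid pos∉C₁ neg∉C₁ pos∉C₂ neg∉C₂
         n I₁ s x∉I₁ p∉I₁ x∉s J₁ I₂ J₂ = record
  { implied = λ M A∧¬C → let
      A-holds , ¬C = to T-∧ A∧¬C
      ¬C₁ , ¬C₂ = ¬C↓A-++⁻ A B X rule M C₁ C₂ π₁ π₂ ¬C
      in A.resolvent-implied a (x∉ab ∘ ∈-++⁺ˡ)
        (λ N A∧¬C₁ ¬ℓ → J₁.implied N
          (insert-∧ N A (projA (neg (a ≐ b)) ab-mixed) (¬C↓A C₁ π₁) A∧¬C₁ ¬ℓ))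
        (λ N A∧¬C₂ ¬ℓ → J₂.implied N
          (insert-∧ N A (projA (pos (a ≐ b)) ab-mixed) (¬C↓A C₂ π₂) A∧¬C₂ ¬ℓ))
        M (from T-∧ (A-holds , ¬C₁)) (from T-∧ (A-holds , ¬C₂))
  ; inconsistent = λ M B∧¬C∧I → let
      B∧¬C , I-holds = to T-∧ B∧¬C∧I
      B-holds , ¬C = to T-∧ B∧¬C
      ¬C₁ , ¬C₂ = ¬C↓B-++⁻ A B X rule M C₁ C₂ π₁ π₂ ¬C
      in B.resolvent-inconsistent b (x∉ab ∘ ∈-++⁺ʳ (symbᵗ a))
        (λ N B∧¬C₁ ¬ℓ I-holds → J₁.inconsistent N (from T-∧
          ( insert-∧ N B (projB (neg (a ≐ b)) ab-mixed) (¬C↓B C₁ π₁) B∧¬C₁ ¬ℓ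
          , I-holds)))
        (λ N B∧¬C₂ ¬ℓ I-holds → J₂.inconsistent N (from T-∧
          ( insert-∧ N B (projB (pos (a ≐ b)) ab-mixed) (¬C↓B C₂ π₂) B∧¬C₂ ¬ℓ
          , I-holds)))
        M (from T-∧ (B-holds , ¬C₁)) (from T-∧ (B-holds , ¬C₂)) I-holds
  ; symbols = symbols
  }
  where
  open Interpolation A B
  open Projection X rule
  open AuxVars X
  open ValidAux valid using (MixedIn)
  module J₁ = IsInterpolant J₁
  module J₂ = IsInterpolant J₂

  x = aux (eq a b)
  p = auxP a b

  mixed : MixedIn (a ≐ b)
  mixed = here refl , mixed-symbᵃ A B X rule a b a-loc b-loc

  x-aux : AuxOf A B X rule (a ≐ b) (funSym x)
  x-aux = aux-var (eq a b)

  p-aux : AuxOf A B X rule (a ≐ b) (relSym p)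
  p-aux = aux-prop a b

  ab-mixed : Projectable (a ≐ b)
  ab-mixed = mixed-≐ a-loc b-loc

  x∉ab : funSym x ∉ symbᵃ (a ≐ b)
  x∉ab = proj₂ (proj₂ (auxOf-fresh A B X rule valid mixed x-aux)) (here refl)

  C₁⊆ : map proj₂ C₁ ⊆ a ≐ b ∷ map proj₂ (C₁ ++ C₂)
  C₁⊆ = there ∘ ⊆.map⁺ proj₂ (⊆.xs⊆xs++ys C₁ C₂)

  C₂⊆ : map proj₂ C₂ ⊆ a ≐ b ∷ map proj₂ (C₁ ++ C₂)
  C₂⊆ = there ∘ ⊆.map⁺ proj₂ (⊆.xs⊆ys++xs C₂ C₁)

  ∉C₁ : ∀ {z} → AuxOf A B X rule (a ≐ b) z → ¬ OccursIn A B X rule C₁ z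
  ∉C₁ z-aux = auxOf-∉ A B X rule valid mixed z-aux C₁ C₁⊆ (atom∉ pos∉C₁ neg∉C₁)

  ∉C₂ : ∀ {z} → AuxOf A B X rule (a ≐ b) z → ¬ OccursIn A B X rule C₂ z
  ∉C₂ z-aux = auxOf-∉ A B X rule valid mixed z-aux C₂ C₂⊆ (atom∉ pos∉C₂ neg∉C₂)

  ∉A : ∀ {C z} (π : Projections C) → AuxOf A B X rule (a ≐ b) z → ¬ OccursIn A B X rule C z →
       z ∉ symb (A ∧ ¬C↓A C π)
  ∉A π z-aux z∉C = [ proj₁ (auxOf-fresh A B X rule valid mixed z-aux)
                   , z∉C ∘ symb-¬C↓A A B X rule _ π ]′ ∘ ∈-++⁻ (symb A)

  ∉B : ∀ {C z} (π : Projections C) → AuxOf A B X rule (a ≐ b) z → ¬ OccursIn A B X rule C z →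
       z ∉ symb (B ∧ ¬C↓B C π)
  ∉B π z-aux z∉C = [ proj₁ (proj₂ (auxOf-fresh A B X rule valid mixed z-aux))
                   , z∉C ∘ symb-¬C↓B A B X rule _ π ]′ ∘ ∈-++⁻ (symb B)

  module A = Resolution x p I₁ s x∉I₁ p∉I₁ x∉s I₂ (A ∧ ¬C↓A C₁ π₁) (A ∧ ¬C↓A C₂ π₂)
    (∉A π₁ x-aux (∉C₁ x-aux)) (∉A π₁ p-aux (∉C₁ p-aux)) (∉A π₂ x-aux (∉C₂ x-aux))

  module B = Resolution x p I₁ s x∉I₁ p∉I₁ x∉s I₂ (B ∧ ¬C↓B C₁ π₁) (B ∧ ¬C↓B C₂ π₂)
    (∉B π₁ x-aux (∉C₁ x-aux)) (∉B π₁ p-aux (∉C₁ p-aux)) (∉B π₂ x-aux (∉C₂ x-aux))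

  Allowed : Symbol Sg → Set
  Allowed z = Shared z ⊎ z ∈ aux¬C (C₁ ++ C₂) (++⁺ π₁ π₂)

  symbols₁ : ∀ {z} → z ≢ funSym x → z ≢ relSym p →
             z ∈ symb (fill I₁ (λ i → EQ⟨ a , b ⟩ (s i))) → Allowed z
  symbols₁ z≢x z≢p z∈I₁ with J₁.symbols z∈I₁
  ... | inj₁ z-shared             = inj₁ z-shared
  ... | inj₂ (here z≡x)           = contradiction z≡x z≢x
  ... | inj₂ (there (here z≡p))   = contradiction z≡p z≢p
  ... | inj₂ (there (there z∈C₁)) = inj₂ (aux¬C-++⁺ˡ A B X rule C₁ C₂ π₁ π₂ z∈C₁)

  symbols₂ : ∀ {z} → z ≢ funSym x → z ∈ symb I₂ → Allowed z
  symbols₂ z≢x z∈I₂ with J₂.symbols z∈I₂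
  ... | inj₁ z-shared     = inj₁ z-shared
  ... | inj₂ (here z≡x)   = contradiction z≡x z≢x
  ... | inj₂ (there z∈C₂) = inj₂ (aux¬C-++⁺ʳ A B X rule C₁ C₂ π₁ π₂ z∈C₂)

  symbols : ∀ {z} → z ∈ symb (fill I₁ (λ i → subst x (s i) I₂)) → Allowed z
  symbols z∈ with symb-fill I₁ _ z∈
  ... | inj₁ z∈I₁ =
    symbols₁ (λ { refl → x∉I₁ z∈I₁ }) (λ { refl → p∉I₁ z∈I₁ }) (symb-skeleton⊆ I₁ _ z∈I₁)
  ... | inj₂ (i , i∈I₁ , z∈sub) with symb-subst x (s i) I₂ z∈sub
  ...   | inj₁ z∈s =
    symbols₁ (λ { refl → x∉s i z∈s }) (λ { refl → relSym∉symbᵗ (s i) z∈s })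
      (i∈I₁ _ (there (∈-++⁺ˡ (there z∈s))))
  ...   | inj₂ (z∈I₂ , z≢x) = symbols₂ z≢x z∈I₂
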